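{- There exists an algorithm solving the local postage stamp problem, i.e. which, given any integers $k, s\ge 1$ and any set $A_k=\{a_1<a_2<\dots<a_k\}$ of $k$ distinct positive integers, outputs the $s$-range $n_s(A_k)$, and which requires $O(k\,s\,a_k)$ assignments, or more precisely $O\bigl(k\,n_s(A_k)+s\,a_k\bigr)$ assignments.
   Context: For positive integers $s,k$ and a set (called a basis, or stamp basis) $A_k=\{a_1<a_2<\dots<a_k\}$ of $k$ distinct positive integers, the $s$-range $n_s(A_k)$ is the largest integer $n\ge 0$ such that for every integer $0\le i\le n$ there exists $(\lambda_1,\dots,\lambda_k)\in\mathbb{N}^k$ (with $0\in\mathbb N$) satisfying $\sum_{j=1}^k\lambda_j\le s$ and $i=\sum_{j=1}^k\lambda_j a_j$. The local postage stamp problem (LPSP) is the determination of the $s$-range $n_s(A_k)$, given $s$ and a basis $A_k$ of size $k$. Cost is measured in number of assignments, i.e. writes to cells of the arrays (tables of integers) used by the algorithm, including their initialization. -}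

module Defs where

open import Algebra.Properties.Monoid.Sum using (sum)
open import Data.Fin as Fin using (Fin; fromℕ; fromℕ<)
open import Data.Integer as ℤ using (ℤ; +_; -[1+_])
open import Data.Maybe using (Maybe; just; nothing; zipWith; _>>=_)
open import Data.Nat using (ℕ; zero; suc; _+_; _*_; _≤_; _<_; _<?_; _≟_; NonZero)
open import Data.Nat.Properties using (+-0-monoid)
open import Data.Product using (_×_; ∃-syntax)
open import Relation.Binary.PropositionalEquality using (_≡_)
open import Relation.Nullary using (¬_; yes; no)

record Basis (k : ℕ) : Set where
  field
    elem       : Fin k → ℕ
    positive   : ∀ j → 0 < elem j
    increasing : ∀ {i j} → i Fin.< j → elem i < elem j

open Basis public

largest : ∀ {k} .{{_ : NonZero k}} → Basis k → ℕ
largest {suc k} A = elem A (fromℕ k)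

Representable : ∀ {k} → ℕ → Basis k → ℕ → Set
Representable {k} s A i =
  ∃[ λs ] sum +-0-monoid {k} λs ≤ s
        × i ≡ sum +-0-monoid {k} (λ j → λs j * elem A j)

Covers : ∀ {k} → ℕ → Basis k → ℕ → Set
Covers s A n = ∀ i → i ≤ n → Representable s A i

IsSRange : ∀ {k} → ℕ → Basis k → ℕ → Set
IsSRange s A n = Covers s A n × (∀ m → Covers s A m → m ≤ n)

-- Algorithms are programs of a deterministic while-language over unbounded
-- integers.  All mutable storage consists of tables (a scalar variable is a
-- table of which one cell is used), so loop counters and temporaries are
-- charged for as well.  A program is a finite syntax tree: it mentions
-- finitely many tables and does not depend on its input.

data Expr : Set where
  lit         : ℤ → Expr
  _[_]        : ℕ → Expr → Expr
  _⊕_ _⊖_     : Expr → Expr → Expr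

data Cond : Set where
  _≤ᶜ_ : Expr → Expr → Cond

data Program : Set where
  skip          : Program
  _[_]≔_        : ℕ → Expr → Expr → Program
  _⨾_           : Program → Program → Program
  if_then_else_ : Cond → Program → Program → Program
  while_loop_     : Cond → Program → Program

infix  8 _[_]
infixl 7 _⊕_ _⊖_
infix  6 _≤ᶜ_
infix  5 _[_]≔_
infix  4 if_then_else_ while_loop_
infixr 3 _⨾_

-- A cell that holds nothing has not been initialised.  Reading it is an error,
-- so a program has to pay for initialising the cells it uses.
Store : Set
Store = ℕ → ℕ → Maybe ℤ

_[_,_↦_] : Store → ℕ → ℕ → ℤ → Store
(σ [ t , i ↦ v ]) t′ i′ with t ≟ t′ | i ≟ i′
... | yes _ | yes _ = just v
... | _     | _     = σ t′ i′

cell : Store → ℕ → ℤ → Maybe ℤ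
cell σ t (+ i)    = σ t i
cell σ t -[1+ _ ] = nothing

eval : Store → Expr → Maybe ℤ
eval σ (lit z)   = just z
eval σ (t [ e ]) = eval σ e >>= cell σ t
eval σ (e ⊕ e′)  = zipWith ℤ._+_ (eval σ e) (eval σ e′)
eval σ (e ⊖ e′)  = zipWith ℤ._-_ (eval σ e) (eval σ e′)

data Holds (σ : Store) : Cond → Set where
  holds : ∀ {e e′ v v′} → eval σ e ≡ just v → eval σ e′ ≡ just v′ →
          v ℤ.≤ v′ → Holds σ (e ≤ᶜ e′)

data Fails (σ : Store) : Cond → Set where
  fails : ∀ {e e′ v v′} → eval σ e ≡ just v → eval σ e′ ≡ just v′ →
          ¬ v ℤ.≤ v′ → Fails σ (e ≤ᶜ e′)

-- ⟨ p , σ ⟩⇓ σ′ # c: started in σ, p terminates without error in σ′ after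
-- exactly c assignments.
data ⟨_,_⟩⇓_#_ : Program → Store → Store → ℕ → Set where
  ⇓-skip   : ∀ {σ} → ⟨ skip , σ ⟩⇓ σ # 0
  ⇓-assign : ∀ {σ t e e′ i v} → eval σ e ≡ just (+ i) → eval σ e′ ≡ just v →
             ⟨ t [ e ]≔ e′ , σ ⟩⇓ (σ [ t , i ↦ v ]) # 1
  ⇓-seq    : ∀ {σ σ′ σ″ p q c d} →
             ⟨ p , σ ⟩⇓ σ′ # c → ⟨ q , σ′ ⟩⇓ σ″ # d →
             ⟨ p ⨾ q , σ ⟩⇓ σ″ # (c + d)
  ⇓-then   : ∀ {σ σ′ b p q c} → Holds σ b → ⟨ p , σ ⟩⇓ σ′ # c →
             ⟨ if b then p else q , σ ⟩⇓ σ′ # c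
  ⇓-else   : ∀ {σ σ′ b p q c} → Fails σ b → ⟨ q , σ ⟩⇓ σ′ # c →
             ⟨ if b then p else q , σ ⟩⇓ σ′ # c
  ⇓-loop   : ∀ {σ σ′ σ″ b p c d} → Holds σ b →
             ⟨ p , σ ⟩⇓ σ′ # c → ⟨ while b loop p , σ′ ⟩⇓ σ″ # d →
             ⟨ while b loop p , σ ⟩⇓ σ″ # (c + d)
  ⇓-exit   : ∀ {σ b p} → Fails σ b → ⟨ while b loop p , σ ⟩⇓ σ # 0

-- Table 0 holds k and s, table 1 holds a₁, …, aₖ (from cell 0 on), and nothing
-- else is initialised.
input : ∀ {k} → ℕ → Basis k → Store
input {k} s A 0 0 = just (+ k)
input {k} s A 0 1 = just (+ s)
input {k} s A 1 j with j <? k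
... | yes j<k = just (+ elem A (fromℕ< j<k))
... | no  _   = nothing
input {k} s A _ _ = nothing

-- The output is read from cell 0 of table 2.
Outputs : ∀ {k} → Program → ℕ → Basis k → (n cost : ℕ) → Set
Outputs P s A n cost =
  ∃[ σ ] ⟨ P , input s A ⟩⇓ σ # cost × σ 2 0 ≡ just (+ n)

{-# OPTIONS --safe #-}

-- Let m(i) be the least number of stamps with sum i.  A nonempty representation
-- uses some aⱼ, so m(i) = 1 + min { m(i - aⱼ) | aⱼ ≤ i }.  Tabulating m until the
-- first value above s takes O(k) assignments for each of the n + 1 positions
-- 1, …, n + 1, where n is the s-range.  This is O(k n + k), and k ≤ aₖ ≤ s aₖ because the
-- aⱼ are distinct positive integers.  The other bound follows from n ≤ s aₖ.

module Submission where

open import Defs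
open import Algebra.Properties.CommutativeMonoid.Sum using (sum-remove)
open import Algebra.Properties.Monoid.Sum using (sum; sum-cong-≗; sum-replicate-zero)
open import Data.Fin as Fin using (Fin; toℕ; fromℕ; fromℕ<; punchIn)
open import Data.Fin.Properties
  using (any?; fromℕ<-toℕ; toℕ-fromℕ<; toℕ<n; toℕ-fromℕ; toℕ-injective; punchInᵢ≢i; toℕ≤pred[n])
open import Data.Integer as ℤ using (ℤ; +_)
open import Data.Integer.Properties as ℤₚ using (drop‿+≤+)
open import Data.Maybe using (just; zipWith; _>>=_)
open import Data.Nat
open import Data.Nat.Properties
open import Data.Nat.Solver using (module +-*-Solver)
open import Data.Product using (_×_; _,_; ∃-syntax)
open import Data.Sum using (inj₁; inj₂)
open import Data.Vec.Functional using (removeAt; updateAt)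
open import Data.Vec.Functional.Properties using (updateAt-updates; updateAt-minimal)
open import Function using (_∘_; const)
open import Relation.Binary.PropositionalEquality hiding ([_])
open import Relation.Nullary using (¬_; yes; no; contradiction)

-- Representations by stamps

Σ : ∀ {k} → (Fin k → ℕ) → ℕ
Σ {k} = sum +-0-monoid {k}

-- Splitting off the term at `j` leaves two equal remainders. The increment `d` is 1 when stamps are
-- counted and `elem A j` when their values are added.
Σ-shift : ∀ {k} (f g : Fin k → ℕ) (j : Fin k) {d} →
          f j ≡ d + g j → (∀ i → i ≢ j → f i ≡ g i) → Σ f ≡ d + Σ g
Σ-shift {suc k} f g j {d} fj≡ f≗g = begin
  Σ f                             ≡⟨ sum-remove +-0-commutativeMonoid {i = j} f ⟩
  f j + Σ (removeAt f j)          ≡⟨ cong₂ _+_ fj≡ (sum-cong-≗ +-0-monoid (λ i → f≗g (punchIn j i) (punchInᵢ≢i j i))) ⟩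
  d + g j + Σ (removeAt g j)      ≡⟨ +-assoc d (g j) _ ⟩
  d + (g j + Σ (removeAt g j))    ≡⟨ cong (_+_ d) (sum-remove +-0-commutativeMonoid {i = j} g) ⟨
  d + Σ g                         ∎
  where open ≡-Reasoning

Σ-weighted-≤ : ∀ {k} (f w : Fin k → ℕ) {L} → (∀ j → w j ≤ L) →
               Σ (λ j → f j * w j) ≤ Σ f * L
Σ-weighted-≤ {zero}  f w w≤L = z≤n
Σ-weighted-≤ {suc k} f w {L} w≤L = begin
  f Fin.zero * w Fin.zero + Σ (λ j → f (Fin.suc j) * w (Fin.suc j))
    ≤⟨ +-mono-≤ (*-monoʳ-≤ (f Fin.zero) (w≤L Fin.zero))
                (Σ-weighted-≤ (f ∘ Fin.suc) (w ∘ Fin.suc) (w≤L ∘ Fin.suc)) ⟩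
  f Fin.zero * L + Σ (f ∘ Fin.suc) * L
    ≡⟨ *-distribʳ-+ L (f Fin.zero) _ ⟨
  Σ f * L ∎
  where open ≤-Reasoning

module _ {k} (A : Basis k) where

  value : (Fin k → ℕ) → ℕ
  value λs = Σ (λ j → λs j * elem A j)

  representable-mono : ∀ {s t i} → s ≤ t → Representable s A i → Representable t A i
  representable-mono s≤t (λs , Σ≤s , i≡) = λs , ≤-trans Σ≤s s≤t , i≡

  representable-zero : ∀ {s} → Representable s A 0
  representable-zero {s} =
    const 0 , ≤-trans (≤-reflexive (sum-replicate-zero +-0-monoid k)) z≤n
            , sym (sum-replicate-zero +-0-monoid k)

  -- Each of at most `s` stamps contributes at most `L`. This bounds the length of the sweep, and
  -- later `n` in the coarse cost.
  representable-≤ : ∀ {s i L} → (∀ j → elem A j ≤ L) → Representable s A i → i ≤ s * L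
  representable-≤ {s} {L = L} a≤L (λs , Σ≤s , refl) =
    ≤-trans (Σ-weighted-≤ λs (elem A) a≤L) (*-monoˡ-≤ L Σ≤s)

  module _ {f g : Fin k → ℕ} (j : Fin k)
           (fj≡ : f j ≡ suc (g j)) (f≗g : ∀ i → i ≢ j → f i ≡ g i) where

    size-stamp : Σ f ≡ suc (Σ g)
    size-stamp = Σ-shift f g j fj≡ f≗g

    value-stamp : value f ≡ elem A j + value g
    value-stamp = Σ-shift _ _ j (cong (_* elem A j) fj≡)
                                (λ i i≢j → cong (_* elem A i) (f≗g i i≢j))

  add-stamp : ∀ {s i} j → Representable s A i → Representable (suc s) A (elem A j + i)
  add-stamp {s} j (λs , Σ≤s , refl) =
    f , subst (_≤ suc s) (sym (size-stamp j fj≡ f≗λs)) (s≤s Σ≤s)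
      , sym (value-stamp j fj≡ f≗λs)
    where
    f = updateAt λs j suc
    fj≡ : f j ≡ suc (λs j)
    fj≡ = updateAt-updates j λs
    f≗λs : ∀ i → i ≢ j → f i ≡ λs i
    f≗λs i i≢j = updateAt-minimal i j λs i≢j

  -- As `i` is positive, some multiplicity is positive, and lowering it by one removes that stamp.
  -- With `add-stamp` this gives both directions of the recurrence.
  remove-stamp : ∀ {s i} → 0 < i → Representable s A i →
                 ∃[ j ] ∃[ t ] ∃[ d ] suc t ≤ s × i ≡ elem A j + d × Representable t A d
  remove-stamp {s} 0<i (λs , Σ≤s , refl) with any? (λ j → 0 <? λs j)
  ... | yes (j , 0<λj) =
    j , Σ g , value g , subst (_≤ s) (size-stamp j λj≡ λs≗g) Σ≤s
      , value-stamp j λj≡ λs≗g , g , ≤-refl , refl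
    where
    g = updateAt λs j pred
    λj≡ : λs j ≡ suc (g j)
    λj≡ = trans (sym (suc-pred (λs j) {{>-nonZero 0<λj}}))
                (cong suc (sym (updateAt-updates j λs)))
    λs≗g : ∀ i → i ≢ j → λs i ≡ g i
    λs≗g i i≢j = sym (updateAt-minimal i j λs i≢j)
  ... | no ∄j = contradiction 0<i (≤⇒≯ (≤-reflexive
    (trans (sum-cong-≗ +-0-monoid λ j → cong (_* elem A j) (none-used j))
           (sum-replicate-zero +-0-monoid k))))
    where
    none-used : ∀ j → λs j ≡ 0
    none-used j = n≤0⇒n≡0 (≮⇒≥ (λ 0<λj → ∄j (j , 0<λj)))

  -- The first element exceeds 0 and each strict increase gains at least one. The induction runs on
  -- the numerical index, because the step goes to the preceding element of the same basis.
  toℕ<elem : ∀ j → toℕ j < elem A j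
  toℕ<elem j = go (toℕ j) j refl
    where
    go : ∀ m i → toℕ i ≡ m → m < elem A i
    go zero    i _  = positive A i
    go (suc m) i i≡ = ≤-<-trans (go m i′ i′≡) (increasing A (≤-reflexive (trans (cong suc i′≡) (sym i≡))))
      where
      m<k : m < k
      m<k = <-trans (≤-reflexive (sym i≡)) (toℕ<n i)
      i′ = fromℕ< m<k
      i′≡ = toℕ-fromℕ< m<k

elem≤largest : ∀ {k} .{{_ : NonZero k}} (A : Basis k) j → elem A j ≤ largest A
elem≤largest {suc k} A j with m≤n⇒m<n∨m≡n (toℕ≤pred[n] j)
... | inj₁ j<k = <⇒≤ (increasing A (subst (toℕ j <_) (sym (toℕ-fromℕ k)) j<k))
... | inj₂ j≡k = ≤-reflexive (cong (elem A) (toℕ-injective (trans j≡k (sym (toℕ-fromℕ k)))))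

size≤largest : ∀ {k} .{{_ : NonZero k}} (A : Basis k) → k ≤ largest A
size≤largest {suc k} A = subst (_< largest A) (toℕ-fromℕ k) (toℕ<elem A (fromℕ k))

-- The dynamic program

-- The current position lives in the output cell, table 3 holds the counts m(i), and table 4 the
-- index of the stamp being tried.
pattern kᵉ  = 0 [ lit (+ 0) ]
pattern sᵉ  = 0 [ lit (+ 1) ]
pattern nᵉ  = 2 [ lit (+ 0) ]
pattern jᵉ  = 4 [ lit (+ 0) ]
pattern aⱼᵉ = 1 [ jᵉ ]
pattern mₙᵉ = 3 [ nᵉ ]
pattern 1+mₙ₋ₐᵉ = lit (+ 1) ⊕ 3 [ nᵉ ⊖ aⱼᵉ ]

tryStamp tryStamps sweep stamps : Program

tryStamp =
  -- This guard keeps the index n - aⱼ nonnegative; the inner test would otherwise be an error.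
  if aⱼᵉ ≤ᶜ nᵉ
    then (if 1+mₙ₋ₐᵉ ≤ᶜ mₙᵉ then 3 [ nᵉ ]≔ 1+mₙ₋ₐᵉ else skip)
    else skip

tryStamps =
  while lit (+ 1) ⊕ jᵉ ≤ᶜ kᵉ loop (tryStamp ⨾ 4 [ lit (+ 0) ]≔ lit (+ 1) ⊕ jᵉ)

sweep =
  while mₙᵉ ≤ᶜ sᵉ loop
    ( 2 [ lit (+ 0) ]≔ lit (+ 1) ⊕ nᵉ
    -- The value s + 1 serves as infinity: if no stamp improves it, the sweep stops here.
    ⨾ 3 [ nᵉ ]≔ lit (+ 1) ⊕ sᵉ
    ⨾ 4 [ lit (+ 0) ]≔ lit (+ 0)
    ⨾ tryStamps )

-- The sweep ends at the first nonrepresentable position, one past the s-range.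
stamps =
    3 [ lit (+ 0) ]≔ lit (+ 0)
  ⨾ 2 [ lit (+ 0) ]≔ lit (+ 0)
  ⨾ sweep
  ⨾ 2 [ lit (+ 0) ]≔ nᵉ ⊖ lit (+ 1)

-- Store updates and evaluation of expressions

update-same : ∀ σ t i {v} → (σ [ t , i ↦ v ]) t i ≡ just v
update-same σ t i with t ≟ t | i ≟ i
... | yes _   | yes _   = refl
... | no t≢t  | _       = contradiction refl t≢t
... | yes _   | no i≢i  = contradiction refl i≢i

update-other : ∀ σ t {i i′ v} → i ≢ i′ → (σ [ t , i ↦ v ]) t i′ ≡ σ t i′
update-other σ t {i} {i′} i≢i′ with t ≟ t | i ≟ i′
... | _     | yes i≡i′ = contradiction i≡i′ i≢i′
... | yes _ | no _     = refl
... | no _  | no _     = refl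

-- A record, unlike the equation itself, determines σ and e when type checking.
record _⊢_⇓_ (σ : Store) (e : Expr) (v : ℕ) : Set where
  constructor evaluates
  field eval≡ : eval σ e ≡ just (+ v)

open _⊢_⇓_

module _ {σ : Store} where

  ⊢-lit : ∀ {v} → σ ⊢ lit (+ v) ⇓ v
  ⊢-lit = evaluates refl

  ⊢-read : ∀ {t e i v} → σ ⊢ e ⇓ i → σ t i ≡ just (+ v) → σ ⊢ t [ e ] ⇓ v
  ⊢-read {t} (evaluates e≡) t≡ = evaluates (trans (cong (_>>= cell σ t) e≡) t≡)

  ⊢-scalar : ∀ {t i v} → σ t i ≡ just (+ v) → σ ⊢ t [ lit (+ i) ] ⇓ v
  ⊢-scalar = ⊢-read ⊢-lit

  ⊢-suc : ∀ {e v} → σ ⊢ e ⇓ v → σ ⊢ lit (+ 1) ⊕ e ⇓ suc v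
  ⊢-suc (evaluates e≡) = evaluates (cong (zipWith ℤ._+_ (just (+ 1))) e≡)

  -- Writing the minuend as `a + d` keeps the difference natural. It serves the two subtractions of
  -- the program, n - aⱼ and the final n - 1.
  ⊢-minus : ∀ {e e′} a {d} → σ ⊢ e ⇓ (a + d) → σ ⊢ e′ ⇓ a → σ ⊢ e ⊖ e′ ⇓ d
  ⊢-minus a {d} (evaluates e≡) (evaluates e′≡) =
    evaluates (trans (cong₂ (zipWith ℤ._-_) e≡ e′≡) (cong just (begin
      + (a + d) ℤ.- + a ≡⟨ ℤₚ.m-n≡m⊖n (a + d) a ⟩
      (a + d) ℤ.⊖ a     ≡⟨ ℤₚ.⊖-≥ (m≤m+n a d) ⟩
      + (a + d ∸ a)     ≡⟨ cong +_ (m+n∸m≡n a d) ⟩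
      + d               ∎)))
    where open ≡-Reasoning

  holds-≤ : ∀ {e e′ v v′} → σ ⊢ e ⇓ v → σ ⊢ e′ ⇓ v′ → v ≤ v′ → Holds σ (e ≤ᶜ e′)
  holds-≤ e⇓ e′⇓ v≤v′ = holds (eval≡ e⇓) (eval≡ e′⇓) (ℤ.+≤+ v≤v′)

  fails-≰ : ∀ {e e′ v v′} → σ ⊢ e ⇓ v → σ ⊢ e′ ⇓ v′ → ¬ v ≤ v′ → Fails σ (e ≤ᶜ e′)
  fails-≰ e⇓ e′⇓ v≰v′ = fails (eval≡ e⇓) (eval≡ e′⇓) (v≰v′ ∘ drop‿+≤+)

  assign : ∀ {t e e′ i v} → σ ⊢ e ⇓ i → σ ⊢ e′ ⇓ v →
           ⟨ t [ e ]≔ e′ , σ ⟩⇓ (σ [ t , i ↦ + v ]) # 1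
  assign e⇓ e′⇓ = ⇓-assign (eval≡ e⇓) (eval≡ e′⇓)

-- Correctness and cost

module _ {k} (s : ℕ) (A : Basis k) where

  -- Counts above s are not determined: any v > s stands for "more than s stamps".
  IsCount : ℕ → ℕ → Set
  IsCount i v = (v ≤ s → Representable v A i)
              × (∀ t → t ≤ s → Representable t A i → v ≤ t)

  -- The same with the last stamp restricted to the first j basis elements.
  IsPartialCount : ℕ → ℕ → ℕ → Set
  IsPartialCount j i v =
      (v ≤ s → Representable v A i)
    × (∀ l → toℕ l < j → ∀ t d → suc t ≤ s → i ≡ elem A l + d →
         Representable t A d → v ≤ suc t)

  -- The invariants are products rather than records so that they are
  -- definitionally unaffected by assignments to other tables.
  InputKept : Store → Set
  InputKept σ = σ 0 0 ≡ just (+ k)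
              × σ 0 1 ≡ just (+ s)
              × (∀ j → σ 1 (toℕ j) ≡ just (+ elem A j))

  Tabulated : Store → ℕ → Set
  Tabulated σ n = ∀ i → i < n → ∃[ v ] σ 3 i ≡ just (+ v) × IsCount i v × v ≤ s

  Sweeping : Store → ℕ → ℕ → Set
  Sweeping σ n v = InputKept σ × σ 2 0 ≡ just (+ n) × Tabulated σ n × σ 3 n ≡ just (+ v)

  -- The recurrence for stamp counts

  isCount-zero : IsCount 0 0
  isCount-zero = (λ _ → representable-zero A) , (λ _ _ _ → z≤n)

  -- Both clauses are vacuous: the value exceeds `s`, and no basis element has been tried.
  partialCount-start : ∀ i → IsPartialCount 0 i (suc s)
  partialCount-start i = (λ s<s → contradiction s<s 1+n≰n) , (λ _ ())

  -- Every representation of a positive `i` has a removable stamp, so once all basis elements are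
  -- allowed the restriction on the last stamp is void.
  partialCount-complete : ∀ {i v} → 0 < i → IsPartialCount k i v → IsCount i v
  partialCount-complete 0<i (rep , min) = rep , λ t t≤s r →
    let l , t′ , d , t′<t , i≡ , r′ = remove-stamp A 0<i r
    in ≤-trans (min l (toℕ<n l) t′ d (≤-trans t′<t t≤s) i≡ r′) t′<t

  -- Lowering the value preserves the bounds for earlier stamps, so only those ending in the new
  -- stamp `j` remain to be checked.
  partialCount-extend : ∀ {i v v′} (j : Fin k) → IsPartialCount (toℕ j) i v → v′ ≤ v →
    (v′ ≤ s → Representable v′ A i) →
    (∀ t d → suc t ≤ s → i ≡ elem A j + d → Representable t A d → v′ ≤ suc t) →
    IsPartialCount (suc (toℕ j)) i v′
  partialCount-extend {i} {v} {v′} j (_ , min) v′≤v rep minⱼ = rep , min′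
    where
    min′ : ∀ l → toℕ l < suc (toℕ j) → ∀ t d → suc t ≤ s → i ≡ elem A l + d →
           Representable t A d → v′ ≤ suc t
    min′ l l≤j t d t<s i≡ r with m≤n⇒m<n∨m≡n (s≤s⁻¹ l≤j)
    ... | inj₁ l<j = ≤-trans v′≤v (min l l<j t d t<s i≡ r)
    ... | inj₂ l≡j with refl ← toℕ-injective l≡j = minⱼ t d t<s i≡ r

  tabulated-update : ∀ {σ n v} → Tabulated σ n → Tabulated (σ [ 3 , n ↦ v ]) n
  tabulated-update {σ} tab i i<n =
    let w , σ≡ , rest = tab i i<n
    in w , trans (update-other σ 3 (>⇒≢ i<n)) σ≡ , rest

  tabulated-suc : ∀ {σ n v} → Tabulated σ n → σ 3 n ≡ just (+ v) → IsCount n v → v ≤ s →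
                  Tabulated σ (suc n)
  tabulated-suc tab σ≡ count v≤s i i≤n with m≤n⇒m<n∨m≡n (s≤s⁻¹ i≤n)
  ... | inj₁ i<n  = tab i i<n
  ... | inj₂ refl = _ , σ≡ , count , v≤s

  -- Cancelling aⱼ identifies `d′` with `d`, where `u` is already minimal.
  cancel-last-stamp : ∀ {d u} j → IsCount d u → ∀ t d′ → suc t ≤ s →
    elem A j + d ≡ elem A j + d′ → Representable t A d′ → suc u ≤ suc t
  cancel-last-stamp {d} j (_ , min) t d′ t<s a+d≡ r
    with refl ← +-cancelˡ-≡ (elem A j) d d′ a+d≡ = s≤s (min t (<⇒≤ t<s) r)

  -- The loops of the program

  tryStamp-correct : ∀ {σ n v} (j : Fin k) → Sweeping σ n v → σ 4 0 ≡ just (+ toℕ j) →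
    IsPartialCount (toℕ j) n v →
    ∃[ σ′ ] ∃[ c ] ∃[ v′ ]
      ⟨ tryStamp , σ ⟩⇓ σ′ # c × c ≤ 1
      × Sweeping σ′ n v′ × σ′ 4 0 ≡ just (+ toℕ j) × IsPartialCount (suc (toℕ j)) n v′
  tryStamp-correct {σ} {n} {v} j inv@(inp@(_ , _ , a≡) , n≡ , tab , v≡) j≡ count@(rep , _)
    with elem A j ≤? n | ⊢-read {σ} {e = jᵉ} (⊢-scalar j≡) (a≡ j)
  ... | no a≰n  | a⇓ =
    σ , 0 , v , ⇓-else (fails-≰ a⇓ (⊢-scalar n≡) a≰n) ⇓-skip , z≤n , inv , j≡
    , partialCount-extend j count ≤-refl rep
        (λ t d _ n≡a+d _ → contradiction (subst (elem A j ≤_) (sym n≡a+d) (m≤m+n _ d)) a≰n)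
  -- Here `d` is n - aⱼ. It is below `n` because aⱼ is positive, so its count is already tabulated.
  ... | yes a≤n | a⇓ with d , refl ← m≤n⇒∃[o]m+o≡n a≤n
      with u , u≡ , countᵈ@(repᵈ , _) , u≤s ← tab d (m<n+m d (positive A j))
      with suc u ≤? v
         | holds-≤ a⇓ (⊢-scalar {t = 2} n≡) a≤n
         | ⊢-suc (⊢-read {t = 3} (⊢-minus (elem A j) (⊢-scalar {t = 2} n≡) a⇓) u≡)
  ...   | no 1+u≰v  | a≤ⁿ | 1+u⇓ =
    σ , 0 , v
    , ⇓-then a≤ⁿ (⇓-else (fails-≰ 1+u⇓ (⊢-read (⊢-scalar n≡) v≡) 1+u≰v) ⇓-skip)
    , z≤n , inv , j≡
    , partialCount-extend j count ≤-refl rep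
        (λ t d′ t<s eq r → ≤-trans (<⇒≤ (≰⇒> 1+u≰v)) (cancel-last-stamp j countᵈ t d′ t<s eq r))
  ...   | yes 1+u≤v | a≤ⁿ | 1+u⇓ =
    _ , 1 , suc u
    , ⇓-then a≤ⁿ (⇓-then (holds-≤ 1+u⇓ (⊢-read (⊢-scalar n≡) v≡) 1+u≤v)
                         (assign (⊢-scalar n≡) 1+u⇓))
    , ≤-refl
    , (inp , n≡ , tabulated-update {σ} tab , update-same σ 3 n) , j≡
    , partialCount-extend j count 1+u≤v (λ _ → add-stamp A j (repᵈ u≤s))
        (cancel-last-stamp j countᵈ)

  -- Induction on the number `r` of stamps still to be tried. Each costs at most two assignments: a
  -- possible improvement and the increment of the counter.
  tryStamps-correct : ∀ r {σ n v} j → j + r ≡ k → Sweeping σ n v → σ 4 0 ≡ just (+ j) →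
    IsPartialCount j n v →
    ∃[ σ′ ] ∃[ c ] ∃[ v′ ]
      ⟨ tryStamps , σ ⟩⇓ σ′ # c × c ≤ r * 2 × Sweeping σ′ n v′ × IsPartialCount k n v′
  tryStamps-correct zero {σ} {v = v} j j+0≡k inv@((k≡ , _) , _) j≡ count
    with refl ← trans (sym (+-identityʳ j)) j+0≡k =
    σ , 0 , v , ⇓-exit (fails-≰ (⊢-suc (⊢-scalar j≡)) (⊢-scalar k≡) 1+n≰n) , z≤n , inv , count
  tryStamps-correct (suc r) {σ} {n} {v} j j+1+r≡k inv@((k≡ , _) , _) j≡ count =
    let σ₁ , c₁ , v₁ , run₁ , c₁≤1 , inv₁ , j≡₁ , count₁ =
          tryStamp-correct l inv (subst (λ x → σ 4 0 ≡ just (+ x)) j≡l j≡)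
                                 (subst (λ x → IsPartialCount x n v) j≡l count)
        j≡₁′ = subst (λ x → σ₁ 4 0 ≡ just (+ x)) (sym j≡l) j≡₁
        σ₂ , c₂ , v₂ , run₂ , c₂≤ , inv₂ , count₂ =
          tryStamps-correct r {σ₁ [ 4 , 0 ↦ + suc j ]} (suc j) 1+j+r≡k inv₁ refl
            (subst (λ x → IsPartialCount (suc x) n v₁) (sym j≡l) count₁)
    in σ₂ , (c₁ + 1) + c₂ , v₂
       , ⇓-loop (holds-≤ (⊢-suc (⊢-scalar j≡)) (⊢-scalar k≡) j<k)
                (⇓-seq run₁ (assign ⊢-lit (⊢-suc (⊢-scalar j≡₁′)))) run₂
       , +-mono-≤ (+-monoˡ-≤ 1 c₁≤1) c₂≤ , inv₂ , count₂
    where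
    1+j+r≡k : suc j + r ≡ k
    1+j+r≡k = trans (sym (+-suc j r)) j+1+r≡k
    j<k : j < k
    j<k = m+n≤o⇒m≤o (suc j) (≤-reflexive 1+j+r≡k)
    l = fromℕ< j<k
    j≡l : j ≡ toℕ l
    j≡l = sym (toℕ-fromℕ< j<k)

  -- All positions below `n` are covered while `n` itself is not, so the range ends just before `n`.
  -- Since 0 is always representable, `n` has a predecessor.
  isSRange-pred : ∀ {σ n v} → Tabulated σ n → IsCount n v → ¬ v ≤ s →
                  ∃[ n′ ] n ≡ suc n′ × IsSRange s A n′
  isSRange-pred {n = zero} _ (_ , min) v≰s =
    contradiction (≤-trans (min 0 z≤n (representable-zero A)) z≤n) v≰s
  isSRange-pred {n = suc n} tab (_ , min) v≰s = n , refl , covers , maximal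
    where
    covers : Covers s A n
    covers i i≤n with _ , _ , (rep , _) , v≤s ← tab i (s≤s i≤n) =
      representable-mono A v≤s (rep v≤s)
    maximal : ∀ m → Covers s A m → m ≤ n
    maximal m cov = ≮⇒≥ (λ n<m → v≰s (min s ≤-refl (cov (suc n) n<m)))

  -- r is fuel: only positions up to s L are representable.
  sweep-correct : ∀ {L} → (∀ j → elem A j ≤ L) → ∀ r {σ n v} → s * L < n + r →
    Sweeping σ n v → IsCount n v →
    ∃[ n′ ] ∃[ σ′ ] ∃[ c ]
      ⟨ sweep , σ ⟩⇓ σ′ # c × c + n * (3 + k * 2) ≤ suc n′ * (3 + k * 2)
      × σ′ 2 0 ≡ just (+ suc n′) × IsSRange s A n′
  sweep-correct {L} a≤L r {σ} {n} {v} fuel (inp@(_ , s≡ , _) , n≡ , tab , v≡) count@(rep , _)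
    with v ≤? s
  ... | no v≰s with n′ , refl , range ← isSRange-pred {σ} tab count v≰s =
    n′ , σ , 0 , ⇓-exit (fails-≰ (⊢-read (⊢-scalar n≡) v≡) (⊢-scalar s≡) v≰s) , ≤-refl , n≡ , range
  -- Out of fuel, `n` exceeds `s * L`, yet a count within `s` would make it representable.
  sweep-correct {L} a≤L zero {σ} {n} {v} fuel _ (rep , _)
      | yes v≤s = contradiction
    (representable-≤ A a≤L (representable-mono A v≤s (rep v≤s)))
    (<⇒≱ (subst (s * L <_) (+-identityʳ n) fuel))
  sweep-correct {L} a≤L (suc r) {σ} {n} {v} fuel (inp@(_ , s≡ , _) , n≡ , tab , v≡) count
      | yes v≤s =
    let σ₁ = σ [ 2 , 0 ↦ + suc n ]
        σ₂ = σ₁ [ 3 , suc n ↦ + suc s ]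
        σ₃ = σ₂ [ 4 , 0 ↦ + 0 ]
        tab₁ : Tabulated σ₁ (suc n)
        tab₁ = tabulated-suc {σ₁} tab v≡ count v≤s
        σ₄ , c₄ , v₄ , run₄ , c₄≤ , inv₄ , count₄ =
          tryStamps-correct k {σ₃} {suc n} 0 refl
            (inp , refl , tabulated-update {σ₁} tab₁ , update-same σ₁ 3 (suc n)) refl
            (partialCount-start (suc n))
        n′ , σ₅ , c₅ , run₅ , c₅≤ , n≡₅ , range =
          sweep-correct a≤L r {σ₄} (subst (s * L <_) (+-suc n r) fuel) inv₄
            (partialCount-complete z<s count₄)
    in n′ , σ₅ , (3 + c₄) + c₅
       , ⇓-loop (holds-≤ (⊢-read (⊢-scalar n≡) v≡) (⊢-scalar s≡) v≤s)
           (⇓-seq (assign ⊢-lit (⊢-suc (⊢-scalar n≡)))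
           (⇓-seq (assign (⊢-scalar refl) (⊢-suc (⊢-scalar s≡)))
           (⇓-seq (assign ⊢-lit ⊢-lit) run₄))) run₅
       , cost c₄ c₅ n′ c₄≤ c₅≤ , n≡₅ , range
    where
    open ≤-Reasoning
    -- Per position: three assignments set up the position, its count and the stamp index, then at
    -- most two for each stamp.
    w = 3 + k * 2
    cost : ∀ c d n′ → c ≤ k * 2 → d + suc n * w ≤ suc n′ * w →
           (3 + c) + d + n * w ≤ suc n′ * w
    cost c d n′ c≤ d≤ = begin
      (3 + c) + d + n * w   ≡⟨ cong (_+ n * w) (+-comm (3 + c) d) ⟩
      d + (3 + c) + n * w   ≡⟨ +-assoc d (3 + c) (n * w) ⟩
      d + ((3 + c) + n * w) ≤⟨ +-monoʳ-≤ d (+-monoˡ-≤ (n * w) (+-monoʳ-≤ 3 c≤)) ⟩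
      d + suc n * w         ≤⟨ d≤ ⟩
      suc n′ * w            ∎

-- The whole program and its cost bounds

input-elem : ∀ {k} s (A : Basis k) j → input s A 1 (toℕ j) ≡ just (+ elem A j)
input-elem {k} s A j with toℕ j <? k
... | yes j<k = cong (λ i → just (+ elem A i)) (fromℕ<-toℕ j j<k)
... | no  j≮k = contradiction (toℕ<n j) j≮k

stamps-correct : ∀ {k} .{{_ : NonZero k}} s (A : Basis k) →
  ∃[ n ] ∃[ cost ] Outputs stamps s A n cost × IsSRange s A n
                   × cost ≤ 3 + suc n * (3 + k * 2)
stamps-correct {k} s A =
  let σ₀ = input s A [ 3 , 0 ↦ + 0 ] [ 2 , 0 ↦ + 0 ]
      n , σ , c , run , c≤ , n≡ , range =
        sweep-correct s A (elem≤largest A) (suc (s * largest A)) {σ₀} ≤-refl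
          ((refl , refl , input-elem s A) , refl , (λ _ ()) , refl) (isCount-zero s A)
  -- Two initialising assignments precede the sweep, and the final decrement follows it.
  in n , 2 + (c + 1)
     , (_ , ⇓-seq (assign ⊢-lit ⊢-lit) (⇓-seq (assign ⊢-lit ⊢-lit)
              (⇓-seq run (assign ⊢-lit (⊢-minus 1 (⊢-scalar n≡) ⊢-lit)))) , refl)
     , range
     , (begin
         2 + (c + 1)               ≡⟨ cong (_+_ 2) (+-comm c 1) ⟩
         3 + c                     ≡⟨ cong (_+_ 3) (+-identityʳ c) ⟨
         3 + (c + 0)               ≤⟨ +-monoʳ-≤ 3 c≤ ⟩
         3 + suc n * (3 + k * 2)   ∎)
  where open ≤-Reasoning

-- As k is at least 1, each constant 3 is absorbed into a multiple of k, giving 3 + 3 + 2 = 8 times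
-- k(n + 1). The leftover k is at most a, hence at most s a.
stamps-cost : ∀ k s a n .{{_ : NonZero k}} .{{_ : NonZero s}} → k ≤ a →
              3 + suc n * (3 + k * 2) ≤ 8 * (k * n + s * a)
stamps-cost k s a n k≤a = begin
  3 + suc n * (3 + k * 2)           ≤⟨ +-mono-≤ (m≤m*n 3 (suc n * k) {{m*n≢0 (suc n) k}})
                                                (*-monoʳ-≤ (suc n) (+-monoˡ-≤ (k * 2) (m≤m*n 3 k))) ⟩
  3 * (suc n * k) + suc n * (3 * k + k * 2)
                                    ≡⟨ solve 2 (λ n k → con 3 :* ((con 1 :+ n) :* k) :+ (con 1 :+ n) :* (con 3 :* k :+ k :* con 2)
                                                     := con 8 :* (k :* n :+ k)) refl n k ⟩
  8 * (k * n + k)                   ≤⟨ *-monoʳ-≤ 8 (+-monoʳ-≤ (k * n) (≤-trans k≤a (m≤n*m a s))) ⟩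
  8 * (k * n + s * a)               ∎
  where
  open ≤-Reasoning
  open +-*-Solver

-- Both summands k n and s a are at most k s a, which doubles the constant 8.
coarse-bound : ∀ k s a n .{{_ : NonZero k}} → n ≤ s * a →
               8 * (k * n + s * a) ≤ 16 * (k * s * a)
coarse-bound k s a n n≤sa = begin
  8 * (k * n + s * a)             ≤⟨ *-monoʳ-≤ 8 (+-mono-≤ (*-monoʳ-≤ k n≤sa) (m≤n*m (s * a) k)) ⟩
  8 * (k * (s * a) + k * (s * a)) ≡⟨ solve 3 (λ k s a → con 8 :* (k :* (s :* a) :+ k :* (s :* a))
                                               := con 16 :* (k :* s :* a)) refl k s a ⟩
  16 * (k * s * a)                ∎
  where
  open ≤-Reasoning
  open +-*-Solver

proposition15 : ∃[ P ] ∃[ C₁ ] ∃[ C₂ ]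
    (∀ (k s : ℕ) .{{_ : NonZero k}} .{{_ : NonZero s}} (A : Basis k) →
    ∃[ n ] ∃[ cost ]
    Outputs P s A n cost
    × IsSRange s A n
    × cost ≤ C₁ * (k * s * largest A)
    × cost ≤ C₂ * (k * n + s * largest A))
proposition15 = stamps , 16 , 8 , λ k s A →
  let n , cost , out , range@(covers , _) , cost≤ = stamps-correct s A
      fine = ≤-trans cost≤ (stamps-cost k s (largest A) n (size≤largest A))
      n≤sa = representable-≤ A (elem≤largest A) (covers n ≤-refl)
  in n , cost , out , range , ≤-trans fine (coarse-bound k s (largest A) n n≤sa) , fine
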